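{- Let $\mathrm{Ax} \subseteq \{\mathsf{N}, \mathsf{P}, \mathsf{T}, \mathsf{D}, \mathsf{K}\}$. Then for every formula $\varphi \in \mathcal{L}$ we have $\Vdash_{\mathsf{IM} \oplus \mathrm{Ax}} \varphi$ if and only if $\vdash_{\mathsf{IM} \oplus \mathrm{Ax}} \varphi$.
   Context: Language: $\mathcal{L}$ is generated by $\varphi ::= p \mid \bot \mid \varphi\wedge\varphi \mid \varphi\vee\varphi \mid \varphi\to\varphi \mid \Box\varphi \mid \Diamond\varphi$ with $p$ ranging over a fixed set $\mathrm{Prop}$ of proposition letters; $\neg\varphi := \varphi\to\bot$, $\top := \neg\bot$. Logics: for a set $\mathcal{R}$ of axioms and rules, $\mathsf{IPL}\oplus\mathcal{R}$ is the logic over $\mathcal{L}$ obtained by extending an axiomatisation of intuitionistic propositional logic with the axioms and rules in $\mathcal{R}$ and closing under modus ponens and uniform substitution. $\mathsf{IM}$ is obtained in this way from the rules $\mathsf{mon}_\Box$: from $\varphi\to\psi$ infer $\Box\varphi\to\Box\psi$; $\mathsf{mon}_\Diamond$: from $\varphi\to\psi$ infer $\Diamond\varphi\to\Diamond\psi$; and the axioms $\mathsf{mnc}$: $(\Box\varphi\wedge\Diamond\neg\varphi)\to\bot$, and $\mathsf{I}_\Diamond$: $(\Box\top\to\Diamond\varphi)\to\Diamond\varphi$. $\mathsf{IM}\oplus\mathrm{Ax}$ additionally has the axioms in $\mathrm{Ax}$, where: $\mathsf{N}$ is $\Box\top$; $\mathsf{P}$ is $\Diamond\top$; $\mathsf{D}$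 is $\Box\varphi\to\Diamond\varphi$; $\mathsf{T}$ is the conjunction of $\Box\varphi\to\varphi$ and $\varphi\to\Diamond\varphi$; $\mathsf{K}$ is the conjunction of $\Box(\varphi\to\psi)\to(\Box\varphi\to\Box\psi)$ and $\Box(\varphi\to\psi)\to(\Diamond\varphi\to\Diamond\psi)$. $\vdash_{\mathsf{L}}\varphi$ means that $\varphi$ is a theorem of $\mathsf{L}$. Semantics: a constructive neighbourhood frame is a tuple $\mathfrak{F}=(W,\leq,N)$ with $W$ a set, $\leq$ a preorder on $W$, and $N: W\to\mathcal{P}(\mathcal{P}(W))$ a function. A model is $\mathfrak{M}=(\mathfrak{F},V)$ where $V$ assigns to each $p\in\mathrm{Prop}$ an upset (upward closed subset) of $(W,\leq)$. Truth at $w\in W$: $w\Vdash p$ iff $w\in V(p)$; $w\Vdash\bot$ never; $\wedge,\vee$ are interpreted pointwise; $w\Vdash\varphi\to\psi$ iff for all $v\geq w$, $v\Vdash\varphi$ implies $v\Vdash\psi$; $w\Vdash\Box\varphi$ iff for all $v\geq w$ there exists $a\in N(v)$ such that $u\Vdash\varphi$ for all $u\in a$; $w\Vdash\Diamond\varphi$ iff for all $v\geq w$ and all $a\in N(v)$ there exists $u\in a$ with $u\Vdash\varphi$. A frame $\mathfrak{F}$ validates $\varphi$ if $(\mathfrak{F},V),w\Vdash\varphi$ for every valuation $V$ and every world $w$, and it validates a set of formulas if it validates each member. $\Vdash_{\mathsf{IM}\oplus\mathrm{Ax}}\varphi$ means that every constructive neighbourhood frame that validates (all formulas in) $\mathsf{IM}\oplus\mathrm{Ax}$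 also validates $\varphi$. -}

module Defs where

open import Data.Empty.Polymorphic using (⊥)
open import Data.Product using (_×_; ∃-syntax)
open import Data.Sum using (_⊎_)
open import Level using (0ℓ; suc; Lift)
open import Relation.Binary.Core using (Rel)
open import Relation.Binary.PropositionalEquality using (_≡_)
open import Relation.Binary.Structures using (IsPreorder)
open import Relation.Unary using (Pred; _∈_; _≐_)

infix  9 `_
infix  8 □_ ◇_ ¬′_
infixr 7 _∧′_
infixr 6 _∨′_
infixr 5 _⇒_

data Form (Atom : Set) : Set where
  `_            : Atom → Form Atom
  ⊥′            : Form Atom
  _∧′_ _∨′_ _⇒_ : Form Atom → Form Atom → Form Atom
  □_ ◇_         : Form Atom → Form Atom

¬′_ : {Atom : Set} → Form Atom → Form Atom
¬′ φ = φ ⇒ ⊥′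

⊤′ : {Atom : Set} → Form Atom
⊤′ = ¬′ ⊥′

_[_] : {Atom : Set} → Form Atom → (Atom → Form Atom) → Form Atom
(` p)    [ σ ] = σ p
⊥′       [ σ ] = ⊥′
(φ ∧′ ψ) [ σ ] = (φ [ σ ]) ∧′ (ψ [ σ ])
(φ ∨′ ψ) [ σ ] = (φ [ σ ]) ∨′ (ψ [ σ ])
(φ ⇒ ψ)  [ σ ] = (φ [ σ ]) ⇒ (ψ [ σ ])
(□ φ)    [ σ ] = □ (φ [ σ ])
(◇ φ)    [ σ ] = ◇ (φ [ σ ])

data IPLAxiom {Atom : Set} : Pred (Form Atom) 0ℓ where
  ⇒-K  : ∀ φ ψ   → IPLAxiom (φ ⇒ ψ ⇒ φ)
  ⇒-S  : ∀ φ ψ χ → IPLAxiom ((φ ⇒ ψ ⇒ χ) ⇒ (φ ⇒ ψ) ⇒ φ ⇒ χ)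
  ∧-I  : ∀ φ ψ   → IPLAxiom (φ ⇒ ψ ⇒ φ ∧′ ψ)
  ∧-E₁ : ∀ φ ψ   → IPLAxiom (φ ∧′ ψ ⇒ φ)
  ∧-E₂ : ∀ φ ψ   → IPLAxiom (φ ∧′ ψ ⇒ ψ)
  ∨-I₁ : ∀ φ ψ   → IPLAxiom (φ ⇒ φ ∨′ ψ)
  ∨-I₂ : ∀ φ ψ   → IPLAxiom (ψ ⇒ φ ∨′ ψ)
  ∨-E  : ∀ φ ψ χ → IPLAxiom ((φ ⇒ χ) ⇒ (ψ ⇒ χ) ⇒ φ ∨′ ψ ⇒ χ)
  ⊥-E  : ∀ φ     → IPLAxiom (⊥′ ⇒ φ)

data AxName : Set where
  N P T D K : AxName

data Instance {Atom : Set} : AxName → Pred (Form Atom) 0ℓ where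
  inst-N :           Instance N (□ ⊤′)
  inst-P :           Instance P (◇ ⊤′)
  inst-D : ∀ φ     → Instance D (□ φ ⇒ ◇ φ)
  inst-T : ∀ φ     → Instance T ((□ φ ⇒ φ) ∧′ (φ ⇒ ◇ φ))
  inst-K : ∀ φ ψ   → Instance K ((□ (φ ⇒ ψ) ⇒ □ φ ⇒ □ ψ) ∧′ (□ (φ ⇒ ψ) ⇒ ◇ φ ⇒ ◇ ψ))

infix 3 IM⊕_⊢_

-- Axioms are schemes, so that the choice of Atom (possibly empty) does not
-- restrict which instances are available.
data IM⊕_⊢_ {Atom : Set} (Ax : Pred AxName 0ℓ) : Form Atom → Set where
  ipl   : ∀ {φ} → IPLAxiom φ → IM⊕ Ax ⊢ φ
  mnc   : ∀ φ → IM⊕ Ax ⊢ (□ φ ∧′ ◇ ¬′ φ) ⇒ ⊥′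
  I◇    : ∀ φ → IM⊕ Ax ⊢ (□ ⊤′ ⇒ ◇ φ) ⇒ ◇ φ
  ax    : ∀ {A φ} → A ∈ Ax → Instance A φ → IM⊕ Ax ⊢ φ
  mon-□ : ∀ {φ ψ} → IM⊕ Ax ⊢ φ ⇒ ψ → IM⊕ Ax ⊢ □ φ ⇒ □ ψ
  mon-◇ : ∀ {φ ψ} → IM⊕ Ax ⊢ φ ⇒ ψ → IM⊕ Ax ⊢ ◇ φ ⇒ ◇ ψ
  mp    : ∀ {φ ψ} → IM⊕ Ax ⊢ φ ⇒ ψ → IM⊕ Ax ⊢ φ → IM⊕ Ax ⊢ ψ
  us    : ∀ {φ} (σ : Atom → Form Atom) → IM⊕ Ax ⊢ φ → IM⊕ Ax ⊢ φ [ σ ]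

-- Subsets of W are predicates. Since predicates with the same elements need
-- not be equal, a set of subsets is a predicate on predicates that respects
-- extensional equality: this is Nbhd-resp.
record Frame : Set₁ where
  field
    W          : Set
    _≤_        : Rel W 0ℓ
    isPreorder : IsPreorder _≡_ _≤_
    Nbhd       : W → Pred (Pred W 0ℓ) 0ℓ
    Nbhd-resp  : ∀ {w a b} → a ≐ b → a ∈ Nbhd w → b ∈ Nbhd w

record Valuation (Atom : Set) (F : Frame) : Set₁ where
  open Frame F
  field
    V      : Atom → Pred W 0ℓ
    upward : ∀ {p w v} → w ≤ v → w ∈ V p → v ∈ V p

-- Truth lives in Set₁ because the clauses for □ and ◇ quantify over subsets.
module _ {Atom : Set} {F : Frame} (M : Valuation Atom F) where
  open Frame F
  open Valuation M

  infix 4 _⊩_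

  _⊩_ : W → Form Atom → Set₁
  w ⊩ (` p)    = Lift (suc 0ℓ) (w ∈ V p)
  w ⊩ ⊥′       = ⊥
  w ⊩ (φ ∧′ ψ) = w ⊩ φ × w ⊩ ψ
  w ⊩ (φ ∨′ ψ) = w ⊩ φ ⊎ w ⊩ ψ
  w ⊩ (φ ⇒ ψ)  = ∀ v → w ≤ v → v ⊩ φ → v ⊩ ψ
  w ⊩ (□ φ)    = ∀ v → w ≤ v → ∃[ a ] a ∈ Nbhd v × (∀ u → u ∈ a → u ⊩ φ)
  w ⊩ (◇ φ)    = ∀ v → w ≤ v → ∀ a → a ∈ Nbhd v → ∃[ u ] u ∈ a × u ⊩ φ

Validates : {Atom : Set} → Frame → Form Atom → Set₁
Validates {Atom} F φ = (M : Valuation Atom F) (w : Frame.W F) → _⊩_ M w φ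

ValidatesLogic : (Atom : Set) → Frame → Pred AxName 0ℓ → Set₁
ValidatesLogic Atom F Ax = (ψ : Form Atom) → IM⊕ Ax ⊢ ψ → Validates F ψ

infix 3 IM⊕_⊩_

IM⊕_⊩_ : {Atom : Set} → Pred AxName 0ℓ → Form Atom → Set₁
IM⊕_⊩_ {Atom} Ax φ = (F : Frame) → ValidatesLogic Atom F Ax → Validates F φ

{-# OPTIONS --safe #-}
-- Completeness by a canonical frame.  A world is a prime theory Γ together with
-- an arbitrary formula ψ, its label; worlds are ordered by inclusion of the
-- theories.  The neighbourhoods of (Γ , ψ) are the sets ⟦χ⟧ with □χ ∈ Γ and, if
-- ◇ψ ∉ Γ, the sets ⟦χ⟧ ∖ ⟦ψ⟧ with □χ ∈ Γ where χ is a theorem or K is an axiom.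
-- The second family refutes ◇ψ; neither family has a member inside ⟦ψ⟧ unless
-- □ψ ∈ Γ, so a world with label ψ also refutes □ψ when □ψ ∉ Γ.  By I◇, a theory
-- without ◇ψ extends to one that contains □⊤ and still not ◇ψ, so the second
-- family is inhabited when it is needed; K makes the neighbourhoods closed under
-- intersection.  The frame conditions do not depend on the valuation, so the
-- frame validates the logic.  To avoid the axiom of choice in Lindenbaum's lemma,
-- theories are taken over the finitely many atoms of the given formula.
module Submission where

open import Defs
open import Axiom.ExcludedMiddle using (ExcludedMiddle)
open import Data.Bool using (Bool) renaming (T to Holds)
open import Data.Empty using (⊥-elim)
import Data.Empty.Polymorphic as Poly
open import Data.Fin using (Fin)
open import Data.List using (List; []; _∷_; _++_; map; length; lookup; allFin; cartesianProductWith)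
open import Data.List.Membership.Propositional using () renaming (_∈_ to _∈ₗ_)
open import Data.List.Membership.Propositional.Properties
  using (∈-++⁺ˡ; ∈-++⁺ʳ; ∈-map⁺; ∈-cartesianProductWith⁺; ∈-allFin)
open import Data.List.Relation.Unary.Any using (here; there; index)
open import Data.List.Relation.Unary.Any.Properties using (lookup-index)
open import Data.Nat using (ℕ; zero; suc; _⊔_; s≤s; _≤′_; ≤′-refl; ≤′-step)
  renaming (_≤_ to _≤ₙ_)
open import Data.Nat.Properties
  using (≤-refl; ≤⇒≤′; m≤m⊔n; m≤n⊔m; m⊔n≤o⇒m≤o; m⊔n≤o⇒n≤o)
open import Data.Product using (Σ-syntax; ∃-syntax; ∃₂; _×_; _,_; proj₁; proj₂)
open import Data.Sum using (_⊎_; inj₁; inj₂; [_,_]′)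
import Data.Sum as Sum
open import Function using (id; _∘_)
open import Function.Bundles using (_⇔_; mk⇔)
open import Level using (Level; 0ℓ; lift)
open import Relation.Binary.PropositionalEquality
  using (_≡_; refl; sym; cong; cong₂; subst; isEquivalence)
open import Relation.Binary.Structures using (IsPreorder)
open import Relation.Nullary using (¬_; yes; no)
open import Relation.Nullary.Decidable using (⌊_⌋; toWitness; fromWitness; decidable-stable)
open import Relation.Unary using (Pred; _∈_; _⊆_; _≐_)
open import Relation.Unary.Properties using (≐-refl; ≐-sym; ≐-trans)

private
  variable
    A B : Set
    Ax  : Pred AxName 0ℓ
    ℓ   : Level

-- Substitution between languages

infix 10 _⟪_⟫

-- `_[_]` stays inside one language; this version allows passing to a language with finitely many
-- atoms and back.
_⟪_⟫ : Form A → (A → Form B) → Form B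
(` p)    ⟪ τ ⟫ = τ p
⊥′       ⟪ τ ⟫ = ⊥′
(φ ∧′ ψ) ⟪ τ ⟫ = φ ⟪ τ ⟫ ∧′ ψ ⟪ τ ⟫
(φ ∨′ ψ) ⟪ τ ⟫ = φ ⟪ τ ⟫ ∨′ ψ ⟪ τ ⟫
(φ ⇒ ψ)  ⟪ τ ⟫ = φ ⟪ τ ⟫ ⇒ ψ ⟪ τ ⟫
(□ φ)    ⟪ τ ⟫ = □ (φ ⟪ τ ⟫)
(◇ φ)    ⟪ τ ⟫ = ◇ (φ ⟪ τ ⟫)

[]-⟪⟫ : (φ : Form A) {σ : A → Form A} {τ : A → Form B} →
        φ ⟪ (λ p → σ p ⟪ τ ⟫) ⟫ ≡ (φ [ σ ]) ⟪ τ ⟫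
[]-⟪⟫ (` p)    = refl
[]-⟪⟫ ⊥′       = refl
[]-⟪⟫ (φ ∧′ ψ) = cong₂ _∧′_ ([]-⟪⟫ φ) ([]-⟪⟫ ψ)
[]-⟪⟫ (φ ∨′ ψ) = cong₂ _∨′_ ([]-⟪⟫ φ) ([]-⟪⟫ ψ)
[]-⟪⟫ (φ ⇒ ψ)  = cong₂ _⇒_ ([]-⟪⟫ φ) ([]-⟪⟫ ψ)
[]-⟪⟫ (□ φ)    = cong □_ ([]-⟪⟫ φ)
[]-⟪⟫ (◇ φ)    = cong ◇_ ([]-⟪⟫ φ)

IPLAxiom-⟪⟫ : {φ : Form A} (τ : A → Form B) → IPLAxiom φ → IPLAxiom (φ ⟪ τ ⟫)
IPLAxiom-⟪⟫ τ (⇒-K _ _)   = ⇒-K _ _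
IPLAxiom-⟪⟫ τ (⇒-S _ _ _) = ⇒-S _ _ _
IPLAxiom-⟪⟫ τ (∧-I _ _)   = ∧-I _ _
IPLAxiom-⟪⟫ τ (∧-E₁ _ _)  = ∧-E₁ _ _
IPLAxiom-⟪⟫ τ (∧-E₂ _ _)  = ∧-E₂ _ _
IPLAxiom-⟪⟫ τ (∨-I₁ _ _)  = ∨-I₁ _ _
IPLAxiom-⟪⟫ τ (∨-I₂ _ _)  = ∨-I₂ _ _
IPLAxiom-⟪⟫ τ (∨-E _ _ _) = ∨-E _ _ _
IPLAxiom-⟪⟫ τ (⊥-E _)     = ⊥-E _

Instance-⟪⟫ : {φ : Form A} {a : AxName} (τ : A → Form B) → Instance a φ → Instance a (φ ⟪ τ ⟫)
Instance-⟪⟫ τ inst-N       = inst-N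
Instance-⟪⟫ τ inst-P       = inst-P
Instance-⟪⟫ τ (inst-D _)   = inst-D _
Instance-⟪⟫ τ (inst-T _)   = inst-T _
Instance-⟪⟫ τ (inst-K _ _) = inst-K _ _

-- One clause for each rule but `us`. The level is arbitrary because one of the two instances,
-- validity in a frame, lives in `Set₁`.
record Closed (Ax : Pred AxName 0ℓ) (Q : Pred (Form B) ℓ) : Set ℓ where
  field
    ipl∈   : ∀ {φ} → IPLAxiom φ → Q φ
    mnc∈   : ∀ φ → Q ((□ φ ∧′ ◇ ¬′ φ) ⇒ ⊥′)
    I◇∈    : ∀ φ → Q ((□ ⊤′ ⇒ ◇ φ) ⇒ ◇ φ)
    ax∈    : ∀ {a φ} → a ∈ Ax → Instance a φ → Q φ
    mon-□∈ : ∀ {φ ψ} → Q (φ ⇒ ψ) → Q (□ φ ⇒ □ ψ)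
    mon-◇∈ : ∀ {φ ψ} → Q (φ ⇒ ψ) → Q (◇ φ ⇒ ◇ ψ)
    mp∈    : ∀ {φ ψ} → Q (φ ⇒ ψ) → Q φ → Q ψ

-- The axioms being schemes, the substitution rule is admissible: generalising
-- over τ absorbs it.
⊢-elim : {Q : Pred (Form B) ℓ} → Closed Ax Q →
         {φ : Form A} → IM⊕ Ax ⊢ φ → (τ : A → Form B) → Q (φ ⟪ τ ⟫)
⊢-elim c (ipl i)    τ = Closed.ipl∈ c (IPLAxiom-⟪⟫ τ i)
⊢-elim c (mnc φ)    τ = Closed.mnc∈ c _
⊢-elim c (I◇ φ)     τ = Closed.I◇∈ c _
⊢-elim c (ax a∈ i)  τ = Closed.ax∈ c a∈ (Instance-⟪⟫ τ i)
⊢-elim c (mon-□ d)  τ = Closed.mon-□∈ c (⊢-elim c d τ)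
⊢-elim c (mon-◇ d)  τ = Closed.mon-◇∈ c (⊢-elim c d τ)
⊢-elim c (mp d e)   τ = Closed.mp∈ c (⊢-elim c d τ) (⊢-elim c e τ)
⊢-elim {Q = Q} c (us {φ} σ d) τ =
  subst Q ([]-⟪⟫ φ) (⊢-elim c d (λ p → σ p ⟪ τ ⟫))

⊢-⟪⟫ : {φ : Form A} → IM⊕ Ax ⊢ φ → (τ : A → Form B) → IM⊕ Ax ⊢ φ ⟪ τ ⟫
⊢-⟪⟫ = ⊢-elim record
  { ipl∈ = ipl ; mnc∈ = mnc ; I◇∈ = I◇ ; ax∈ = ax ; mon-□∈ = mon-□ ; mon-◇∈ = mon-◇ ; mp∈ = mp }

⟪`⟫ : (φ : Form A) → φ ⟪ `_ ⟫ ≡ φ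
⟪`⟫ (` p)    = refl
⟪`⟫ ⊥′       = refl
⟪`⟫ (φ ∧′ ψ) = cong₂ _∧′_ (⟪`⟫ φ) (⟪`⟫ ψ)
⟪`⟫ (φ ∨′ ψ) = cong₂ _∨′_ (⟪`⟫ φ) (⟪`⟫ ψ)
⟪`⟫ (φ ⇒ ψ)  = cong₂ _⇒_ (⟪`⟫ φ) (⟪`⟫ ψ)
⟪`⟫ (□ φ)    = cong □_ (⟪`⟫ φ)
⟪`⟫ (◇ φ)    = cong ◇_ (⟪`⟫ φ)

-- Frame conditions

module _ (F : Frame) where
  open Frame F

  Serial : W → Set₁
  Serial w = ∃[ a ] a ∈ Nbhd w

  -- Sufficient conditions for the schemes. For `K`, a common refinement of `a` and `b` takes the
  -- place of their intersection.
  FrameCondition : AxName → Set₁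
  FrameCondition N = ∀ w → Serial w
  FrameCondition P = ∀ {w a} → a ∈ Nbhd w → ∃[ u ] u ∈ a
  FrameCondition T = ∀ {w a} → a ∈ Nbhd w → w ∈ a
  FrameCondition D = ∀ {w a b} → a ∈ Nbhd w → b ∈ Nbhd w → ∃[ u ] u ∈ a × u ∈ b
  FrameCondition K = ∀ {w a b} → a ∈ Nbhd w → b ∈ Nbhd w → ∃[ c ] c ∈ Nbhd w × c ⊆ a × c ⊆ b

-- Soundness under the frame conditions

module Soundness (F : Frame) {Ax : Pred AxName 0ℓ}
  (serial-mono : ∀ {w v} → Frame._≤_ F w v → Serial F w → Serial F v)
  (conditions  : ∀ {a} → a ∈ Ax → FrameCondition F a)
  {B : Set} (M : Valuation B F) where

  open Frame F
  open Valuation M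
  open IsPreorder isPreorder using () renaming (refl to ≤-refl′; trans to ≤-trans′)

  private
    _⊨_ : W → Form B → Set₁
    _⊨_ = _⊩_ M

    Valid : Form B → Set₁
    Valid φ = ∀ w → w ⊨ φ

  persistent : ∀ φ {w v} → w ≤ v → w ⊨ φ → v ⊨ φ
  persistent (` p)    w≤v (lift h) = lift (upward w≤v h)
  persistent (φ ∧′ ψ) w≤v (h , k)  = persistent φ w≤v h , persistent ψ w≤v k
  persistent (φ ∨′ ψ) w≤v          = Sum.map (persistent φ w≤v) (persistent ψ w≤v)
  persistent (φ ⇒ ψ)  w≤v h x v≤x  = h x (≤-trans′ w≤v v≤x)
  persistent (□ φ)    w≤v h x v≤x  = h x (≤-trans′ w≤v v≤x)
  persistent (◇ φ)    w≤v h x v≤x  = h x (≤-trans′ w≤v v≤x)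

  ⊨-ipl : ∀ {φ} → IPLAxiom φ → Valid φ
  ⊨-ipl (⇒-K φ ψ)   _ v _ h x v≤x _ = persistent φ v≤x h
  ⊨-ipl (⇒-S φ ψ χ) _ v _ h x v≤x k y x≤y l =
    h y (≤-trans′ v≤x x≤y) l y ≤-refl′ (k y x≤y l)
  ⊨-ipl (∧-I φ ψ)   _ v _ h x v≤x k = persistent φ v≤x h , k
  ⊨-ipl (∧-E₁ φ ψ)  _ v _ = proj₁
  ⊨-ipl (∧-E₂ φ ψ)  _ v _ = proj₂
  ⊨-ipl (∨-I₁ φ ψ)  _ v _ = inj₁
  ⊨-ipl (∨-I₂ φ ψ)  _ v _ = inj₂
  ⊨-ipl (∨-E φ ψ χ) _ v _ h x v≤x k y x≤y =
    [ h y (≤-trans′ v≤x x≤y) , k y x≤y ]′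
  ⊨-ipl (⊥-E φ)     _ v _ = Poly.⊥-elim

  ⊨-⊤ : Valid ⊤′
  ⊨-⊤ _ _ _ h = h

  ⊨-instance : ∀ {a φ} → Instance a φ → FrameCondition F a → Valid φ
  ⊨-instance inst-N cond w v w≤v with cond v
  ... | a , a∈N = a , a∈N , λ u _ → ⊨-⊤ u
  ⊨-instance inst-P cond w v w≤v a a∈N with cond a∈N
  ... | u , u∈a = u , u∈a , ⊨-⊤ u
  ⊨-instance (inst-D φ) cond w v w≤v h x v≤x b b∈N with h x v≤x
  ... | a , a∈N , a⊨φ with cond a∈N b∈N
  ... | u , u∈a , u∈b = u , u∈b , a⊨φ u u∈a
  ⊨-instance (inst-T φ) cond w =
    (λ v w≤v h → let a , a∈N , a⊨φ = h v ≤-refl′ in a⊨φ v (cond a∈N)) ,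
    (λ v w≤v h x v≤x a a∈N → x , cond a∈N , persistent φ v≤x h)
  ⊨-instance (inst-K φ ψ) cond w = □-part , ◇-part
    where
    □-part : w ⊨ (□ (φ ⇒ ψ) ⇒ □ φ ⇒ □ ψ)
    □-part v w≤v h x v≤x k y x≤y with h y (≤-trans′ v≤x x≤y) | k y x≤y
    ... | a , a∈N , a⊨φ⇒ψ | b , b∈N , b⊨φ with cond a∈N b∈N
    ... | c , c∈N , c⊆a , c⊆b =
      c , c∈N , λ u u∈c → a⊨φ⇒ψ u (c⊆a u∈c) u ≤-refl′ (b⊨φ u (c⊆b u∈c))

    ◇-part : w ⊨ (□ (φ ⇒ ψ) ⇒ ◇ φ ⇒ ◇ ψ)
    ◇-part v w≤v h x v≤x k y x≤y b b∈N with h y (≤-trans′ v≤x x≤y)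
    ... | a , a∈N , a⊨φ⇒ψ with cond a∈N b∈N
    ... | c , c∈N , c⊆a , c⊆b with k y x≤y c c∈N
    ... | u , u∈c , u⊨φ = u , c⊆b u∈c , a⊨φ⇒ψ u (c⊆a u∈c) u ≤-refl′ u⊨φ

  ⊨-closed : Closed Ax Valid
  ⊨-closed = record
    { ipl∈   = ⊨-ipl
    ; mnc∈   = λ φ w v w≤v (h , k) →
        let a , a∈N , a⊨φ   = h v ≤-refl′
            u , u∈a , u⊨¬φ  = k v ≤-refl′ a a∈N
        in u⊨¬φ u ≤-refl′ (a⊨φ u u∈a)
    -- The given neighbourhood `a` makes `x` serial, `serial-mono` carries this to all worlds above
    -- `x`, and so `□ ⊤′` holds at `x`.
    ; I◇∈    = λ φ w v w≤v h x v≤x a a∈N →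
        h x v≤x
          (λ y x≤y → let b , b∈N = serial-mono x≤y (a , a∈N) in b , b∈N , λ u _ → ⊨-⊤ u)
          x ≤-refl′ a a∈N
    ; ax∈    = λ a∈Ax i → ⊨-instance i (conditions a∈Ax)
    ; mon-□∈ = λ h w v w≤v k x v≤x →
        let a , a∈N , a⊨φ = k x v≤x
        in a , a∈N , λ u u∈a → h u u ≤-refl′ (a⊨φ u u∈a)
    ; mon-◇∈ = λ h w v w≤v k x v≤x a a∈N →
        let u , u∈a , u⊨φ = k x v≤x a a∈N
        in u , u∈a , h u u ≤-refl′ u⊨φ
    ; mp∈    = λ h k w → h w w ≤-refl′ (k w)
    }

  sound : ∀ {φ} → IM⊕ Ax ⊢ φ → Valid φ
  sound {φ} d = subst Valid (⟪`⟫ φ) (⊢-elim ⊨-closed d `_)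

-- Theories

-- Closure is asked under modus ponens alone: the monotonicity rules act on theorems, and the theory
-- of a world need not respect them.
record Theory (A : Set) (Ax : Pred AxName 0ℓ) : Set₁ where
  infix 4 _∋_
  field
    _∋_  : Form A → Set
    thm  : ∀ {φ} → IM⊕ Ax ⊢ φ → _∋_ φ
    _·_  : ∀ {φ ψ} → _∋_ (φ ⇒ ψ) → _∋_ φ → _∋_ ψ

  infixl 8 _·_

open Theory using (_∋_; thm)

Theorems : (A : Set) (Ax : Pred AxName 0ℓ) → Theory A Ax
Theorems A Ax = record { _∋_ = IM⊕ Ax ⊢_ ; thm = id ; _·_ = mp }

module _ (X : Theory A Ax) where
  open Theory X using (_·_)

  weaken : ∀ {φ ψ} → X ∋ φ → X ∋ ψ ⇒ φ
  weaken h = thm X (ipl (⇒-K _ _)) · h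

  ⇒-refl : ∀ φ → X ∋ φ ⇒ φ
  ⇒-refl φ = thm X (ipl (⇒-S φ (φ ⇒ φ) φ)) · thm X (ipl (⇒-K _ _)) · thm X (ipl (⇒-K _ _))

  -- By the deduction theorem, this is the theory generated by X and φ.
  infixl 6 _▷_
  _▷_ : Form A → Theory A Ax
  _▷_ φ = record
    { _∋_ = λ ψ → X ∋ φ ⇒ ψ
    ; thm = λ d → weaken (thm X d)
    ; _·_ = λ h k → thm X (ipl (⇒-S _ _ _)) · h · k
    }

  ∋-∧ : ∀ {φ ψ} → X ∋ φ → X ∋ ψ → X ∋ φ ∧′ ψ
  ∋-∧ h k = thm X (ipl (∧-I _ _)) · h · k

  ∋-∧₁ : ∀ {φ ψ} → X ∋ φ ∧′ ψ → X ∋ φ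
  ∋-∧₁ h = thm X (ipl (∧-E₁ _ _)) · h

  ∋-∧₂ : ∀ {φ ψ} → X ∋ φ ∧′ ψ → X ∋ ψ
  ∋-∧₂ h = thm X (ipl (∧-E₂ _ _)) · h

  ∋-⊤ : X ∋ ⊤′
  ∋-⊤ = ⇒-refl ⊥′

  ∋-□-mono : ∀ {φ ψ} → IM⊕ Ax ⊢ φ ⇒ ψ → X ∋ □ φ → X ∋ □ ψ
  ∋-□-mono d h = thm X (mon-□ d) · h

  ∋-◇-mono : ∀ {φ ψ} → IM⊕ Ax ⊢ φ ⇒ ψ → X ∋ ◇ φ → X ∋ ◇ ψ
  ∋-◇-mono d h = thm X (mon-◇ d) · h

∋-□⊤ : (X : Theory A Ax) {φ : Form A} → X ∋ □ φ → X ∋ □ ⊤′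
∋-□⊤ X = ∋-□-mono X (weaken (Theorems _ _) (∋-⊤ (Theorems _ _)))

-- Enumeration of the formulas over finitely many atoms

module Enumeration {A : Set} (atoms : List A) (complete : ∀ p → p ∈ₗ atoms) where

  depth : Form A → ℕ
  depth (` p)    = 1
  depth ⊥′       = 1
  depth (φ ∧′ ψ) = suc (depth φ ⊔ depth ψ)
  depth (φ ∨′ ψ) = suc (depth φ ⊔ depth ψ)
  depth (φ ⇒ ψ)  = suc (depth φ ⊔ depth ψ)
  depth (□ φ)    = suc (depth φ)
  depth (◇ φ)    = suc (depth φ)

  -- Finite levels exhaust the formulas, which serves the Lindenbaum construction without numbering
  -- single formulas. The least depth is 1, so level 0 is empty.
  level : ℕ → List (Form A)
  level zero    = []
  level (suc n) =
    map `_ atoms ++ ⊥′ ∷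
    cartesianProductWith _∧′_ l l ++ cartesianProductWith _∨′_ l l ++
    cartesianProductWith _⇒_ l l ++ map □_ l ++ map ◇_ l
    where
    l = level n

  ∈-level : ∀ φ {n} → depth φ ≤ₙ n → φ ∈ₗ level n
  ∈-level (` p) (s≤s _) = ∈-++⁺ˡ (∈-map⁺ `_ (complete p))
  ∈-level ⊥′    (s≤s _) = ∈-++⁺ʳ (map `_ atoms) (here refl)
  ∈-level (φ ∧′ ψ) {suc n} (s≤s h) = ∈-++⁺ʳ (map `_ atoms) (there
    (∈-++⁺ˡ (∈-cartesianProductWith⁺ _∧′_
      (∈-level φ (m⊔n≤o⇒m≤o _ _ h)) (∈-level ψ (m⊔n≤o⇒n≤o _ _ h)))))
  ∈-level (φ ∨′ ψ) {suc n} (s≤s h) = ∈-++⁺ʳ (map `_ atoms) (there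
    (∈-++⁺ʳ (cartesianProductWith _∧′_ (level n) (level n))
    (∈-++⁺ˡ (∈-cartesianProductWith⁺ _∨′_
      (∈-level φ (m⊔n≤o⇒m≤o _ _ h)) (∈-level ψ (m⊔n≤o⇒n≤o _ _ h))))))
  ∈-level (φ ⇒ ψ) {suc n} (s≤s h) = ∈-++⁺ʳ (map `_ atoms) (there
    (∈-++⁺ʳ (cartesianProductWith _∧′_ (level n) (level n))
    (∈-++⁺ʳ (cartesianProductWith _∨′_ (level n) (level n))
    (∈-++⁺ˡ (∈-cartesianProductWith⁺ _⇒_
      (∈-level φ (m⊔n≤o⇒m≤o _ _ h)) (∈-level ψ (m⊔n≤o⇒n≤o _ _ h)))))))
  ∈-level (□ φ) {suc n} (s≤s h) = ∈-++⁺ʳ (map `_ atoms) (there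
    (∈-++⁺ʳ (cartesianProductWith _∧′_ (level n) (level n))
    (∈-++⁺ʳ (cartesianProductWith _∨′_ (level n) (level n))
    (∈-++⁺ʳ (cartesianProductWith _⇒_ (level n) (level n))
    (∈-++⁺ˡ (∈-map⁺ □_ (∈-level φ h)))))))
  ∈-level (◇ φ) {suc n} (s≤s h) = ∈-++⁺ʳ (map `_ atoms) (there
    (∈-++⁺ʳ (cartesianProductWith _∧′_ (level n) (level n))
    (∈-++⁺ʳ (cartesianProductWith _∨′_ (level n) (level n))
    (∈-++⁺ʳ (cartesianProductWith _⇒_ (level n) (level n))
    (∈-++⁺ʳ (map □_ (level n)) (∈-map⁺ ◇_ (∈-level φ h)))))))

-- Prime theories

-- Membership is Boolean-valued so that the worlds form a Set.
record World (A : Set) (Ax : Pred AxName 0ℓ) : Set where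
  field
    label      : Form A
    contains   : Form A → Bool
    theorem    : ∀ {φ} → IM⊕ Ax ⊢ φ → Holds (contains φ)
    modus      : ∀ {φ ψ} → Holds (contains (φ ⇒ ψ)) → Holds (contains φ) → Holds (contains ψ)
    consistent : ¬ Holds (contains ⊥′)
    prime      : ∀ {φ ψ} → Holds (contains (φ ∨′ ψ)) → Holds (contains φ) ⊎ Holds (contains ψ)

  theory : Theory A Ax
  theory = record { _∋_ = λ φ → Holds (contains φ) ; thm = theorem ; _·_ = modus }

open World using (label; theory)

-- Lindenbaum's lemma

module Lindenbaum (em : ∀ {ℓ} → ExcludedMiddle ℓ)
  {A : Set} (atoms : List A) (complete : ∀ p → p ∈ₗ atoms)
  {Ax : Pred AxName 0ℓ} (X : Theory A Ax) (θ : Form A) (X∌θ : ¬ X ∋ θ) where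

  open Enumeration atoms complete
  open Theory X using (_·_)

  -- `χ ⇒ θ` acts as the negation of `χ` relative to the formula `θ` to be avoided.
  Decides : Form A → Form A → Set
  Decides δ χ = X ▷ δ ∋ χ ⊎ X ▷ δ ∋ χ ⇒ θ

  ▷-mono : ∀ {δ δ′ χ} → IM⊕ Ax ⊢ δ′ ⇒ δ → X ▷ δ ∋ χ → X ▷ δ′ ∋ χ
  ▷-mono {δ′ = δ′} d h = Theory._·_ (X ▷ δ′) (weaken X h) (thm X d)

  ⊢-trans : ∀ {φ ψ χ : Form A} → IM⊕ Ax ⊢ φ ⇒ ψ → IM⊕ Ax ⊢ ψ ⇒ χ → IM⊕ Ax ⊢ φ ⇒ χ
  ⊢-trans d e = mp (mp (ipl (⇒-S _ _ _)) (weaken (Theorems A Ax) e)) d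

  -- Finitely many additions to `X` amount to their conjunction, so the single formula `δ` records
  -- them. Each `χ` is added unless that would yield `θ`, and then `χ ⇒ θ` is present already.
  refine : (l : List (Form A)) (δ : Form A) → ¬ X ▷ δ ∋ θ →
           ∃[ δ′ ] (IM⊕ Ax ⊢ δ′ ⇒ δ) × (¬ X ▷ δ′ ∋ θ) × (∀ {χ} → χ ∈ₗ l → Decides δ′ χ)
  refine [] δ δ∌θ = δ , ⇒-refl (Theorems A Ax) δ , δ∌θ , λ ()
  refine (χ ∷ l) δ δ∌θ with em {P = X ▷ δ ▷ χ ∋ θ}
  ... | yes h with refine l δ δ∌θ
  ...   | δ′ , d , δ′∌θ , dec = δ′ , d , δ′∌θ , λ where
            (here refl) → inj₂ (▷-mono d h)
            (there i)   → dec i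
  refine (χ ∷ l) δ δ∌θ | no h with refine l (δ ∧′ χ) (h ∘ curry)
    where
    curry : X ▷ (δ ∧′ χ) ∋ θ → X ▷ δ ▷ χ ∋ θ
    curry k = Theory._·_ (X ▷ δ ▷ χ) (weaken (X ▷ δ) (weaken X k)) (thm X (ipl (∧-I _ _)))
  ...   | δ′ , d , δ′∌θ , dec = δ′ , ⊢-trans d (ipl (∧-E₁ _ _)) , δ′∌θ , λ where
            (here refl) → inj₁ (thm X (⊢-trans d (ipl (∧-E₂ _ _))))
            (there i)   → dec i

  stage : ℕ → ∃[ δ ] ¬ X ▷ δ ∋ θ
  stage zero    = ⊤′ , λ h → X∌θ (h · ∋-⊤ X)
  stage (suc n) with refine (level n) (proj₁ (stage n)) (proj₂ (stage n))
  ... | δ′ , _ , δ′∌θ , _ = δ′ , δ′∌θ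

  stageTheory : ℕ → Theory A Ax
  stageTheory n = X ▷ proj₁ (stage n)

  stage-step : ∀ n → IM⊕ Ax ⊢ proj₁ (stage (suc n)) ⇒ proj₁ (stage n)
  stage-step n = proj₁ (proj₂ (refine (level n) (proj₁ (stage n)) (proj₂ (stage n))))

  stage-mono : ∀ {m n} → m ≤′ n → IM⊕ Ax ⊢ proj₁ (stage n) ⇒ proj₁ (stage m)
  stage-mono ≤′-refl                  = ⇒-refl (Theorems A Ax) _
  stage-mono {n = suc n} (≤′-step m≤n) = ⊢-trans (stage-step n) (stage-mono m≤n)

  -- `χ` lies in the level numbered by its depth, which is treated in passing from the stage of that
  -- number to the next; hence `suc`.
  stage-decides : ∀ χ → Decides (proj₁ (stage (suc (depth χ)))) χ
  stage-decides χ =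
    proj₂ (proj₂ (proj₂ (refine (level n) (proj₁ (stage n)) (proj₂ (stage n)))))
      (∈-level χ ≤-refl)
    where n = depth χ

  Limit : Theory A Ax
  Limit = record
    { _∋_ = λ χ → ∃[ n ] stageTheory n ∋ χ
    ; thm = λ d → 0 , thm (stageTheory 0) d
    ; _·_ = λ (m , h) (n , k) → m ⊔ n ,
        Theory._·_ (stageTheory (m ⊔ n))
          (▷-mono (stage-mono (≤⇒≤′ (m≤m⊔n m n))) h)
          (▷-mono (stage-mono (≤⇒≤′ (m≤n⊔m m n))) k)
    }

  open Theory Limit using () renaming (_·_ to _∙_)

  Limit∌θ : ¬ Limit ∋ θ
  Limit∌θ (n , h) = proj₂ (stage n) h

  Limit-maximal : ∀ χ → Limit ∋ χ ⊎ Limit ∋ χ ⇒ θ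
  Limit-maximal χ = Sum.map (suc (depth χ) ,_) (suc (depth χ) ,_) (stage-decides χ)

  -- By maximality a disjunct outside `Limit` implies `θ` there; if both did, the disjunction would
  -- bring in `θ`.
  Limit-prime : ∀ {φ ψ} → Limit ∋ φ ∨′ ψ → Limit ∋ φ ⊎ Limit ∋ ψ
  Limit-prime {φ} {ψ} h with Limit-maximal φ | Limit-maximal ψ
  ... | inj₁ k | _      = inj₁ k
  ... | _      | inj₁ k = inj₂ k
  ... | inj₂ k | inj₂ l =
    ⊥-elim (Limit∌θ (thm Limit (ipl (∨-E _ _ _)) ∙ k ∙ l ∙ h))

  limitWorld : Form A → World A Ax
  limitWorld ψ = record
    { label      = ψ
    ; contains   = λ χ → ⌊ em {P = Limit ∋ χ} ⌋
    ; theorem    = λ d → fromWitness (thm Limit d)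
    ; modus      = λ h k → fromWitness (toWitness h ∙ toWitness k)
    ; consistent = λ h → Limit∌θ (thm Limit (ipl (⊥-E θ)) ∙ toWitness h)
    ; prime      = λ h → Sum.map fromWitness fromWitness (Limit-prime (toWitness h))
    }

  lindenbaum : ∀ ψ → Σ[ w ∈ World A Ax ]
    label w ≡ ψ × (∀ {χ} → X ∋ χ → theory w ∋ χ) × ¬ theory w ∋ θ
  lindenbaum ψ = limitWorld ψ , refl , (λ h → fromWitness (0 , weaken X h)) , Limit∌θ ∘ toWitness

-- The canonical frame

module Canonical (em : ∀ {ℓ} → ExcludedMiddle ℓ)
  {A : Set} (atoms : List A) (complete : ∀ p → p ∈ₗ atoms) (Ax : Pred AxName 0ℓ) where

  private
    W : Set
    W = World A Ax

    ⊢_ : Form A → Set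
    ⊢ φ = IM⊕ Ax ⊢ φ

    infix 3 ⊢_

  infix 4 _∋ʷ_ _≼_
  infix 5 _∖_

  _∋ʷ_ : W → Form A → Set
  w ∋ʷ φ = theory w ∋ φ

  _≼_ : W → W → Set
  w ≼ v = ∀ {φ} → w ∋ʷ φ → v ∋ʷ φ

  stable : ∀ {w φ} → ¬ ¬ w ∋ʷ φ → w ∋ʷ φ
  stable = decidable-stable em

  extend : (X : Theory A Ax) {θ : Form A} → ¬ X ∋ θ → ∀ ψ →
           Σ[ w ∈ W ] label w ≡ ψ × (∀ {χ} → X ∋ χ → theory w ∋ χ) × ¬ w ∋ʷ θ
  extend X X∌θ = Lindenbaum.lindenbaum em atoms complete X _ X∌θ

  -- Turns the question whether the set `χ ∖ θ` meets the worlds containing `ρ` into one of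
  -- derivability.
  separate : ∀ {χ ρ θ} → ¬ (⊢ χ ⇒ ρ ⇒ θ) → Σ[ u ∈ W ] u ∋ʷ χ × u ∋ʷ ρ × ¬ u ∋ʷ θ
  separate {χ} {ρ} ⊬ with extend (Theorems A Ax ▷ χ ▷ ρ) ⊬ ⊥′
  ... | u , _ , X⊆u , u∌θ =
    u , X⊆u (ipl (⇒-K _ _)) , X⊆u (weaken (Theorems A Ax) (⇒-refl (Theorems A Ax) ρ)) , u∌θ

  _∖_ : Form A → Form A → Pred W 0ℓ
  (χ ∖ θ) u = u ∋ʷ χ × ¬ u ∋ʷ θ

  -- Both families take the shape `χ ∖ θ`: in the plain one `θ` is `⊥′`, which no world contains, so
  -- nothing is removed.
  data Basic (w : W) (χ : Form A) : Form A → Set where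
    plain   : w ∋ʷ □ χ → Basic w χ ⊥′
    labeled : w ∋ʷ □ χ → ¬ w ∋ʷ ◇ label w → (⊢ χ) ⊎ K ∈ Ax → Basic w χ (label w)

  frame : Frame
  frame = record
    { W          = W
    ; _≤_        = _≼_
    ; isPreorder = record
      { isEquivalence = isEquivalence
      ; reflexive     = λ where refl → id
      ; trans         = λ w≼v v≼u → v≼u ∘ w≼v
      }
    ; Nbhd       = λ w a → ∃₂ λ χ θ → Basic w χ θ × a ≐ (χ ∖ θ)
    ; Nbhd-resp  = λ a≐b (χ , θ , b , a≐) → χ , θ , b , ≐-trans (≐-sym a≐b) a≐
    }

  Basic-□ : ∀ {w χ θ} → Basic w χ θ → w ∋ʷ □ χ
  Basic-□ (plain □χ)       = □χ
  Basic-□ (labeled □χ _ _) = □χ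

  module _ (w : W) where
    private
      X = theory w
    open Theory X using (_·_)

    D-◇ : ∀ {φ} → D ∈ Ax → w ∋ʷ □ φ → w ∋ʷ ◇ φ
    D-◇ d h = thm X (ax d (inst-D _)) · h

    K-□ : ∀ {φ ψ} → K ∈ Ax → w ∋ʷ □ (φ ⇒ ψ) → w ∋ʷ □ φ → w ∋ʷ □ ψ
    K-□ k h l = ∋-∧₁ X (thm X (ax k (inst-K _ _))) · h · l

    K-◇ : ∀ {φ ψ} → K ∈ Ax → w ∋ʷ □ (φ ⇒ ψ) → w ∋ʷ ◇ φ → w ∋ʷ ◇ ψ
    K-◇ k h l = ∋-∧₂ X (thm X (ax k (inst-K _ _))) · h · l

    K-∧ : ∀ {φ ψ} → K ∈ Ax → w ∋ʷ □ φ → w ∋ʷ □ ψ → w ∋ʷ □ (φ ∧′ ψ)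
    K-∧ k h l = K-□ k (∋-□-mono X (ipl (∧-I _ _)) h) l

    -- With `separate`, each neighbourhood meets `ρ` whenever `◇ ρ` is in `w`. In the labeled case a
    -- derivation would put `◇ label w` in `w`: by `mon-◇` if `χ` is a theorem, by `K` in the other
    -- case.
    Basic-◇ : ∀ {χ θ ρ} → Basic w χ θ → w ∋ʷ ◇ ρ → ¬ (⊢ χ ⇒ ρ ⇒ θ)
    -- In the plain case mnc is applied to ¬ρ.
    Basic-◇ (plain □χ) ◇ρ d =
      World.consistent w (thm X (mnc _) · ∋-∧ X (∋-□-mono X d □χ)
        (∋-◇-mono X ρ⇒¬¬ρ ◇ρ))
      where
      ρ⇒¬¬ρ : ∀ {ρ} → ⊢ ρ ⇒ ¬′ ¬′ ρ
      ρ⇒¬¬ρ {ρ} = Theory._·_ (Theorems A Ax ▷ ρ ▷ (¬′ ρ))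
        (weaken (Theorems A Ax) (⇒-refl (Theorems A Ax) _)) (ipl (⇒-K _ _))
    Basic-◇ (labeled □χ ∌◇ (inj₁ ⊢χ)) ◇ρ d = ∌◇ (∋-◇-mono X (mp d ⊢χ) ◇ρ)
    Basic-◇ (labeled □χ ∌◇ (inj₂ k))  ◇ρ d = ∌◇ (K-◇ k (∋-□-mono X d □χ) ◇ρ)

    -- The box half of `T` puts `w` in `χ`. The diamond half keeps it out of its label, whose `◇` is
    -- not in `w`.
    Basic-T : ∀ {χ θ} → T ∈ Ax → Basic w χ θ → w ∈ (χ ∖ θ)
    Basic-T t b = ∋-∧₁ X axT · Basic-□ b , ∌θ b
      where
      axT : ∀ {φ} → w ∋ʷ (□ φ ⇒ φ) ∧′ (φ ⇒ ◇ φ)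
      axT = thm X (ax t (inst-T _))
      ∌θ : ∀ {χ θ} → Basic w χ θ → ¬ w ∋ʷ θ
      ∌θ (plain _)         = World.consistent w
      ∌θ (labeled _ ∌◇ _) = ∌◇ ∘ (∋-∧₂ X axT ·_)

    Basic-K : ∀ {χ χ′ θ} → K ∈ Ax → Basic w χ θ → w ∋ʷ □ χ′ → Basic w χ′ θ
    Basic-K k (plain _)        □χ′ = plain □χ′
    Basic-K k (labeled _ ∌◇ _) □χ′ = labeled □χ′ ∌◇ (inj₂ k)

    -- At a given `w` only `⊥′` and the label are ever removed, so of two removals one includes the
    -- other. This is what makes intersections keep the shape `χ ∖ θ`.
    Basic-linear : ∀ {χ χ′ θ θ′} → Basic w χ θ → Basic w χ′ θ′ →
      (∀ u → ¬ u ∋ʷ θ → ¬ u ∋ʷ θ′) ⊎ (∀ u → ¬ u ∋ʷ θ′ → ¬ u ∋ʷ θ)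
    Basic-linear b               (plain _)       = inj₁ λ u _ → World.consistent u
    Basic-linear (plain _)       b               = inj₂ λ u _ → World.consistent u
    Basic-linear (labeled _ _ _) (labeled _ _ _) = inj₁ λ _ → id

    -- Take the neighbourhood with the larger removal. `D` turns the box of the other one into a
    -- diamond, so `Basic-◇` yields a common point.
    Basic-D : ∀ {χ χ′ θ θ′} → D ∈ Ax → Basic w χ θ → Basic w χ′ θ′ →
              ∃[ u ] u ∈ (χ ∖ θ) × u ∈ (χ′ ∖ θ′)
    Basic-D d b b′ with Basic-linear b b′
    ... | inj₁ f with separate (Basic-◇ b (D-◇ d (Basic-□ b′)))
    ...   | u , u∋χ , u∋χ′ , u∌θ = u , (u∋χ , u∌θ) , (u∋χ′ , f u u∌θ)
    Basic-D d b b′ | inj₂ f with separate (Basic-◇ b′ (D-◇ d (Basic-□ b)))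
    ...   | u , u∋χ′ , u∋χ , u∌θ′ = u , (u∋χ , f u u∌θ′) , (u∋χ′ , u∌θ′)

    Basic-∩ : ∀ {χ χ′ θ θ′} → K ∈ Ax → Basic w χ θ → Basic w χ′ θ′ →
      ∃[ η ] Basic w (χ ∧′ χ′) η × (χ ∧′ χ′ ∖ η) ⊆ (χ ∖ θ) × (χ ∧′ χ′ ∖ η) ⊆ (χ′ ∖ θ′)
    Basic-∩ {θ = θ} {θ′} k b b′ with K-∧ k (Basic-□ b) (Basic-□ b′) | Basic-linear b b′
    ... | □∧ | inj₁ f = θ , Basic-K k b □∧ ,
      (λ {u} (h , ∌) → ∋-∧₁ (theory u) h , ∌) , (λ {u} (h , ∌) → ∋-∧₂ (theory u) h , f u ∌)
    ... | □∧ | inj₂ f = θ′ , Basic-K k b′ □∧ ,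
      (λ {u} (h , ∌) → ∋-∧₁ (theory u) h , f u ∌) , (λ {u} (h , ∌) → ∋-∧₂ (theory u) h , ∌)

  serial : ∀ {w χ} → w ∋ʷ □ χ → Serial frame w
  serial □χ = _ , _ , _ , plain □χ , ≐-refl

  -- A neighbourhood of either kind comes from some `□ χ` in the theory, and this passes to larger
  -- theories whatever their labels.
  serial-mono : ∀ {w v} → w ≼ v → Serial frame w → Serial frame v
  serial-mono w≼v (_ , _ , _ , b , _) = serial (w≼v (Basic-□ b))

  conditions : ∀ {a} → a ∈ Ax → FrameCondition frame a
  conditions {N} n w = serial (thm (theory w) (ax n inst-N))
  conditions {P} p {w} (_ , _ , b , _ , χ∖θ⊆a)
    with separate (Basic-◇ w b (thm (theory w) (ax p inst-P)))
  ... | u , u∋χ , _ , u∌θ = u , χ∖θ⊆a (u∋χ , u∌θ)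
  conditions {T} t {w} (_ , _ , b , _ , χ∖θ⊆a) = χ∖θ⊆a (Basic-T w t b)
  conditions {D} d {w} (_ , _ , b , _ , ⊆a) (_ , _ , b′ , _ , ⊆a′) with Basic-D w d b b′
  ... | u , u∈ , u∈′ = u , ⊆a u∈ , ⊆a′ u∈′
  conditions {K} k {w} (_ , _ , b , _ , ⊆a) (_ , _ , b′ , _ , ⊆a′) with Basic-∩ w k b b′
  ... | _ , b∩ , ⊆₁ , ⊆₂ = _ , (_ , _ , b∩ , ≐-refl) , (λ {u} → ⊆a ∘ ⊆₁ {u}) , (λ {u} → ⊆a′ ∘ ⊆₂ {u})

  -- Truth lemma

  module _ {B : Set} (ρ : B → Form A) where

    -- Formulas keep their atoms in `B` while worlds are theories over `A`, so validity over `B` can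
    -- be tested in a frame built from finitely many atoms.
    valuation : Valuation B frame
    valuation = record { V = λ p w → w ∋ʷ ρ p ; upward = λ w≼v → w≼v }

    private
      infix 4 _⊨_
      _⊨_ : W → Form B → Set₁
      _⊨_ = _⊩_ valuation

    truth⇒ : ∀ φ {w} → w ⊨ φ → w ∋ʷ φ ⟪ ρ ⟫
    truth⇐ : ∀ φ {w} → w ∋ʷ φ ⟪ ρ ⟫ → w ⊨ φ

    truth⇒ (` p)        (lift h) = h
    truth⇒ (φ ∧′ ψ) {w} (h , k)  = ∋-∧ (theory w) (truth⇒ φ h) (truth⇒ ψ k)
    truth⇒ (φ ∨′ ψ) {w} (inj₁ h) = World.modus w (thm (theory w) (ipl (∨-I₁ _ _))) (truth⇒ φ h)
    truth⇒ (φ ∨′ ψ) {w} (inj₂ h) = World.modus w (thm (theory w) (ipl (∨-I₂ _ _))) (truth⇒ ψ h)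
    truth⇒ (φ ⇒ ψ) {w} h = stable {w} λ ∌⇒ →
      let v , _ , X⊆v , v∌ψ = extend (theory w ▷ φ ⟪ ρ ⟫) ∌⇒ ⊥′
      in v∌ψ (truth⇒ ψ (h v (X⊆v ∘ weaken (theory w))
           (truth⇐ φ (X⊆v (⇒-refl (theory w) _)))))
    -- Relabelling by `φ ⟪ ρ ⟫` keeps the theory, so the new world is above `w`. With the box
    -- missing, no `χ` whose box is present provably implies `φ ⟪ ρ ⟫`. Hence each neighbourhood has
    -- a world without it, as only `⊥′` or that label is removed.
    truth⇒ (□ φ) {w} h = stable {w} λ ∌□ → refute ∌□ (h (relabel w) id)
      where
      relabel : W → W
      relabel v = record
        { label = φ ⟪ ρ ⟫ ; contains = contains ; theorem = theorem
        ; modus = modus ; consistent = consistent ; prime = prime }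
        where open World v using (contains; theorem; modus; consistent; prime)

      refute : ¬ w ∋ʷ □ (φ ⟪ ρ ⟫) →
               ¬ (∃[ a ] a ∈ Frame.Nbhd frame (relabel w) × (∀ u → u ∈ a → u ⊨ φ))
      refute ∌□ (a , (χ , θ , b , _ , χ∖θ⊆a) , a⊨φ) =
        let u , _ , X⊆u , u∌φ = extend (Theorems A Ax ▷ χ)
              (λ d → ∌□ (∋-□-mono (theory w) d (Basic-□ b))) ⊥′
        in u∌φ (truth⇒ φ (a⊨φ u (χ∖θ⊆a (X⊆u (⇒-refl (Theorems A Ax) χ) , ∌θ u u∌φ b))))
        where
        ∌θ : ∀ u {χ θ} → ¬ u ∋ʷ φ ⟪ ρ ⟫ → Basic (relabel w) χ θ → ¬ u ∋ʷ θ
        ∌θ u u∌φ (plain _)       = World.consistent u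
        ∌θ u u∌φ (labeled _ _ _) = u∌φ
    truth⇒ (◇ φ) {w} h = stable {w} λ ∌◇ → refute ∌◇
      (extend (theory w ▷ □ ⊤′) (λ k → ∌◇ (World.modus w (thm (theory w) (I◇ _)) k)) (φ ⟪ ρ ⟫))
      where
      refute : ¬ w ∋ʷ ◇ (φ ⟪ ρ ⟫) →
               ¬ (Σ[ v ∈ W ] label v ≡ φ ⟪ ρ ⟫ ×
                   (∀ {χ} → theory w ▷ □ ⊤′ ∋ χ → v ∋ʷ χ) × ¬ v ∋ʷ ◇ (φ ⟪ ρ ⟫))
      refute ∌◇ (v , refl , X⊆v , v∌◇)
        with h v (X⊆v ∘ weaken (theory w)) (⊤′ ∖ label v)
               (⊤′ , label v ,
                labeled (X⊆v (⇒-refl (theory w) _)) v∌◇ (inj₁ (∋-⊤ (Theorems A Ax))) , ≐-refl)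
      ... | u , (_ , u∌φ) , u⊨φ = u∌φ (truth⇒ φ u⊨φ)

    truth⇐ (` p)        h = lift h
    truth⇐ ⊥′       {w} h = ⊥-elim (World.consistent w h)
    truth⇐ (φ ∧′ ψ) {w} h = truth⇐ φ (∋-∧₁ (theory w) h) , truth⇐ ψ (∋-∧₂ (theory w) h)
    truth⇐ (φ ∨′ ψ) {w} h = Sum.map (truth⇐ φ) (truth⇐ ψ) (World.prime w h)
    truth⇐ (φ ⇒ ψ)      h v w≼v k = truth⇐ ψ (World.modus v (w≼v h) (truth⇒ φ k))
    truth⇐ (□ φ)        h v w≼v =
      (φ ⟪ ρ ⟫ ∖ ⊥′) , (_ , _ , plain (w≼v h) , ≐-refl) , λ u (u∋φ , _) → truth⇐ φ u∋φ
    truth⇐ (◇ φ)        h v w≼v a (_ , _ , b , _ , χ∖θ⊆a) =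
      let u , u∋χ , u∋φ , u∌θ = separate (Basic-◇ v b (w≼v h))
      in u , χ∖θ⊆a (u∋χ , u∌θ) , truth⇐ φ u∋φ

    complete-⟪⟫ : ∀ φ → IM⊕ Ax ⊩ φ → IM⊕ Ax ⊢ φ ⟪ ρ ⟫
    complete-⟪⟫ φ valid = decidable-stable em λ ⊬φ →
      let w , _ , _ , w∌φ = extend (Theorems A Ax) ⊬φ ⊥′
      in w∌φ (truth⇒ φ (valid frame (λ _ d M → Soundness.sound frame serial-mono conditions M d)
           valuation w))

-- Restriction to the atoms of a formula

atomsOf : Form A → List A
atomsOf (` p)    = p ∷ []
atomsOf ⊥′       = []
atomsOf (φ ∧′ ψ) = atomsOf φ ++ atomsOf ψ
atomsOf (φ ∨′ ψ) = atomsOf φ ++ atomsOf ψ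
atomsOf (φ ⇒ ψ)  = atomsOf φ ++ atomsOf ψ
atomsOf (□ φ)    = atomsOf φ
atomsOf (◇ φ)    = atomsOf φ

⟪⟫-retract : (φ : Form A) {ρ : A → Form B} {τ : B → Form A} →
  (∀ {p} → p ∈ₗ atomsOf φ → ρ p ⟪ τ ⟫ ≡ ` p) → φ ⟪ ρ ⟫ ⟪ τ ⟫ ≡ φ
⟪⟫-retract (` p)    h = h (here refl)
⟪⟫-retract ⊥′       h = refl
⟪⟫-retract (φ ∧′ ψ) h = cong₂ _∧′_ (⟪⟫-retract φ (h ∘ ∈-++⁺ˡ)) (⟪⟫-retract ψ (h ∘ ∈-++⁺ʳ (atomsOf φ)))
⟪⟫-retract (φ ∨′ ψ) h = cong₂ _∨′_ (⟪⟫-retract φ (h ∘ ∈-++⁺ˡ)) (⟪⟫-retract ψ (h ∘ ∈-++⁺ʳ (atomsOf φ)))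
⟪⟫-retract (φ ⇒ ψ)  h = cong₂ _⇒_ (⟪⟫-retract φ (h ∘ ∈-++⁺ˡ)) (⟪⟫-retract ψ (h ∘ ∈-++⁺ʳ (atomsOf φ)))
⟪⟫-retract (□ φ)    h = cong □_ (⟪⟫-retract φ h)
⟪⟫-retract (◇ φ)    h = cong ◇_ (⟪⟫-retract φ h)

module _ (em : ∀ {ℓ} → ExcludedMiddle ℓ) {A : Set} (l : List A) where

  toFin : A → Form (Fin (length l))
  toFin p with em {P = p ∈ₗ l}
  ... | yes i = ` index i
  -- A default for the atoms outside `l`.
  ... | no  _ = ⊥′

  fromFin : Fin (length l) → Form A
  fromFin i = ` lookup l i

  -- `l` may repeat `p`; whichever occurrence is chosen, looking it up returns `p`.
  toFin-fromFin : ∀ {p} → p ∈ₗ l → toFin p ⟪ fromFin ⟫ ≡ ` p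
  toFin-fromFin {p} p∈l with em {P = p ∈ₗ l}
  ... | yes i  = cong `_ (sym (lookup-index i))
  ... | no p∉l = ⊥-elim (p∉l p∈l)

theorem2p14 : (∀ {ℓ} → ExcludedMiddle ℓ) →
    (Atom : Set) (Ax : Pred AxName 0ℓ) (φ : Form Atom) →
    (IM⊕ Ax ⊩ φ) ⇔ (IM⊕ Ax ⊢ φ)
-- Soundness is immediate, since the frames considered validate every theorem.
theorem2p14 em Atom Ax φ = mk⇔ completeness (λ d F valid → valid φ d)
  where
  l = atomsOf φ

  completeness : IM⊕ Ax ⊩ φ → IM⊕ Ax ⊢ φ
  -- The translation of `φ` into finitely many atoms is derivable; translating the derivation back
  -- returns `φ`.
  completeness valid = subst (IM⊕ Ax ⊢_) (⟪⟫-retract φ (toFin-fromFin em l))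
    (⊢-⟪⟫ (Canonical.complete-⟪⟫ em (allFin _) ∈-allFin Ax (toFin em l) φ valid) (fromFin em l))
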